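{- Let $A$ be a finite alphabet with $|A|=k$, and let $L\subseteq A^*$ be $n$-PT. Let $m=f_k(n)$. Then $I(L)$ is $(m+1)$-PT.
   Context: For words $u,v$, $u\sqsubseteq v$ (subword) means $u=a_1\cdots a_\ell$ with letters $a_i$ and $v=v_0a_1v_1\cdots a_\ell v_\ell$ for some words $v_i$. $u\perp v$ means $u\not\sqsubseteq v$ and $v\not\sqsubseteq u$. $I(L)=\{u\in A^*~|~\exists v\in L: u\perp v\}$. For $n\in\mathbb{N}$, $u\sim_n v$ iff $u$ and $v$ have exactly the same subwords of length at most $n$; $L$ is $n$-PT if it is a union of $\sim_n$-classes. The functions $f_k:\mathbb{N}\to\mathbb{N}$ ($k\geq1$) are defined by $f_1(n)=n$ and $f_{k+1}(n)=\max_{0\leq m\leq n}\bigl(m f_k(n+1-m)+m+f_k(n-m)\bigr)$. -}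

module Defs where

open import Data.List.Base using (List; length; map; upTo)
open import Data.List.Extrema.Nat using (max)
open import Data.List.Relation.Binary.Sublist.Propositional using (_⊆_)
open import Data.Nat.Base using (ℕ; suc; _+_; _*_; _∸_; _≤_; NonZero)
open import Data.Product.Base using (∃; _×_)
open import Function.Bundles using (_⇔_)
open import Level using (Level; _⊔_) renaming (suc to lsuc)
open import Relation.Nullary.Negation.Core using (¬_)
open import Relation.Unary using (Pred; _∈_; _≐_)

private
  variable
    a ℓ : Level

-- Words are lists, and the subword relation u ⊑ v is the library's
-- (order-preserving, not necessarily contiguous) sublist relation u ⊆ v.

infix 4 _⊥_ _∼[_]_

_⊥_ : {A : Set a} → List A → List A → Set a
u ⊥ v = ¬ (u ⊆ v) × ¬ (v ⊆ u)

I : {A : Set a} → Pred (List A) ℓ → Pred (List A) (a ⊔ ℓ)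
I L u = ∃ λ v → v ∈ L × u ⊥ v

_∼[_]_ : {A : Set a} → List A → ℕ → List A → Set a
u ∼[ n ] v = ∀ w → length w ≤ n → w ⊆ u ⇔ w ⊆ v

-- A collection of ∼[ n ]-classes is given by a set S of representatives.
_-PT_ : {A : Set a} → ℕ → Pred (List A) ℓ → Set (a ⊔ lsuc ℓ)
_-PT_ {ℓ = ℓ} {A = A} n L =
  ∃ λ (S : Pred (List A) ℓ) → L ≐ (λ v → ∃ λ u → u ∈ S × u ∼[ n ] v)

-- The recurrence's index m ranges over 0, …, n, so the subtractions never
-- truncate; the default value 0 of max is immaterial as the list is non-empty.
f : (k : ℕ) .{{_ : NonZero k}} → ℕ → ℕ
f 1             n = n
f (suc (suc k)) n =
  max 0 (map (λ m → m * f (suc k) (n + 1 ∸ m) + m + f (suc k) (n ∸ m))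
             (upTo (suc n)))

{-# OPTIONS --safe #-}
module Submission where

open import Data.Fin.Base using (Fin)
import Data.Fin.Properties as Fin
open import Data.List.Base
  using (List; []; _∷_; [_]; _++_; length; map; take; drop; replicate; allFin)
open import Data.List.Extrema.Nat using (xs≤max)
import Data.List.Membership.DecPropositional as DecMembership
open import Data.List.Membership.Propositional using (_∈_; find)
open import Data.List.Membership.Propositional.Properties
  using (∈-++⁺ˡ; ∈-++⁺ʳ; ∈-++⁻; ∈-∃++; ∈-map⁺; ∈-upTo⁺; ∈-allFin)
open import Data.List.Properties
  using (++-assoc; length-++; length-map; length-replicate; length-take; length-tabulate;
         take++drop≡id; ∷-injectiveˡ; ∷-injectiveʳ)
import Data.List.Relation.Binary.Sublist.DecPropositional as DecSublist
open import Data.List.Relation.Binary.Sublist.Propositional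
  using (_⊆_; []; _∷_; _∷ʳ_; ⊆-refl; ⊆-trans; ⊆-reflexive; ⊆-antisym; minimum; from∈)
open import Data.List.Relation.Binary.Sublist.Propositional.Properties
  using (∷ˡ⁻; ∷ʳ⁻; ∷⁻; ++⁺; ++⁺ˡ; ++⁺ʳ; take-⊆; length-mono-≤; All-resp-⊆; Any-resp-⊆)
open import Data.List.Relation.Unary.All as All using (All; []; _∷_)
open import Data.List.Relation.Unary.All.Properties as All using (¬All⇒Any¬)
open import Data.List.Relation.Unary.Any using (here; there)
open import Data.Nat.Base
  using (ℕ; zero; suc; _+_; _*_; _∸_; _≤_; _<_; z≤n; s≤s; s≤s⁻¹; NonZero)
open import Data.Nat.Properties
open import Data.Nat.Solver using (module +-*-Solver)
open import Data.Product.Base using (∃; ∃₂; _×_; _,_; proj₁; proj₂)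
open import Data.Sum.Base as Sum using (_⊎_; inj₁; inj₂)
open import Function.Base using (_∘_; id)
open import Function.Bundles using (_↔_; Inverse; Equivalence; mk⇔)
open import Function.Construct.Composition using (_⇔-∘_)
open import Function.Properties.Inverse using (Inverse⇒Injection)
open import Level using (Level)
open import Relation.Binary.Definitions using (DecidableEquality)
open import Relation.Binary.PropositionalEquality
  using (_≡_; _≢_; refl; sym; trans; cong; cong₂; subst)
open import Relation.Nullary using (¬_; yes; no; contradiction)
open import Relation.Nullary.Decidable using (via-injection)
open import Relation.Unary using (Pred; Decidable)
open import Defs

-- Two ingredients. First, every v has a subword v₀ ∼ₙ v of length at most m = f_k(n): split off
-- minimal prefixes containing all letters; each block minus its last letter uses only k − 1
-- letters and may be shortened recursively. Second, if xy ∼ₙ xby then xy ∼ₙ xbʲy for all j.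
--
-- Let u ∼ u′ at level m + 1, v ∈ L and u ⊥ v; we may assume |u′| > m, as otherwise u = u′.
-- Every w between v₀ and v lies in L, so if |w| ≤ m + 1 and w ⋢ u, then w ⊥ u′. Otherwise write
-- v₀ = xy with xby ⊑ v. As u and v are incomparable they are not both of the form xbⁱy, so one
-- of them contains a one-letter extension w ≠ xby of xy. By assumption w ⊑ u either way, hence
-- w ⊑ u′; but no xbʲy contains w, so u′ is a subword of no xbʲy. As xbʲy ∈ L, a large j gives
-- xbʲy ⊥ u′.
module Words {a} {A : Set a} (_≟_ : DecidableEquality A) where

  open DecSublist _≟_ using (_⊆?_)
  open DecMembership _≟_ using (_∈?_)

  -- Subwords of concatenations and of powers of a letter.

  ⊆-++⁻ : ∀ u {v t : List A} → t ⊆ u ++ v → ∃₂ λ r s → t ≡ r ++ s × r ⊆ u × s ⊆ v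
  ⊆-++⁻ []      t⊆v            = [] , _ , refl , [] , t⊆v
  ⊆-++⁻ (c ∷ u) (.c ∷ʳ t⊆)     = let r , s , eq , r⊆u , s⊆v = ⊆-++⁻ u t⊆ in
    r , s , eq , c ∷ʳ r⊆u , s⊆v
  ⊆-++⁻ (c ∷ u) (refl ∷ t⊆)    = let r , s , eq , r⊆u , s⊆v = ⊆-++⁻ u t⊆ in
    c ∷ r , s , cong (c ∷_) eq , refl ∷ r⊆u , s⊆v

  ⊆-replicate⁻ : ∀ j {b : A} {t} → t ⊆ replicate j b → ∃ λ i → t ≡ replicate i b
  ⊆-replicate⁻ zero    []          = 0 , refl
  ⊆-replicate⁻ (suc j) (_ ∷ʳ t⊆)   = ⊆-replicate⁻ j t⊆
  ⊆-replicate⁻ (suc j) (refl ∷ t⊆) = let i , eq = ⊆-replicate⁻ j t⊆ in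
    suc i , cong (_ ∷_) eq

  replicate-++-∷ : ∀ i {b : A} {y} → replicate i b ++ b ∷ y ≡ b ∷ replicate i b ++ y
  replicate-++-∷ zero    = refl
  replicate-++-∷ (suc i) = cong (_ ∷_) (replicate-++-∷ i)

  length-insert : ∀ x {b : A} {y} → length (x ++ b ∷ y) ≡ suc (length (x ++ y))
  length-insert []      = refl
  length-insert (c ∷ x) = cong suc (length-insert x)

  ⊆-length⇒≡ : ∀ {u v : List A} → u ⊆ v → length v ≤ length u → u ≡ v
  ⊆-length⇒≡ []           _  = refl
  ⊆-length⇒≡ (_ ∷ʳ u⊆v)   le = contradiction (length-mono-≤ u⊆v) (<⇒≱ le)
  ⊆-length⇒≡ (refl ∷ u⊆v) le = cong (_ ∷_) (⊆-length⇒≡ u⊆v (s≤s⁻¹ le))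

  ++-insert-⊆ : ∀ {p u q v} {c : A} → p ⊆ u ++ [ c ] → q ⊆ v → p ++ q ⊆ u ++ c ∷ v
  ++-insert-⊆ {p} {u} {q} {v} {c} p⊆ q⊆ =
    subst (p ++ q ⊆_) (++-assoc u [ c ] v) (++⁺ p⊆ q⊆)

  -- One-letter insertions and the words obtained by repeating the letter.

  module _ (b : A) where

    ∷-⊈-pumped : ∀ {e} → e ≢ b → ∀ j x {y} → ¬ (e ∷ x ++ y ⊆ x ++ replicate j b ++ y)
    ∷-⊈-pumped e≢b zero    []      p           = 1+n≰n (length-mono-≤ p)
    ∷-⊈-pumped e≢b (suc j) []      p           = ∷-⊈-pumped e≢b j [] (∷ʳ⁻ e≢b p)
    ∷-⊈-pumped e≢b j       (c ∷ x) (.c ∷ʳ p)   =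
      ∷-⊈-pumped e≢b j x (⊆-trans (refl ∷ c ∷ʳ ⊆-refl) p)
    ∷-⊈-pumped e≢b j       (c ∷ x) (refl ∷ p)  = ∷-⊈-pumped e≢b j x p

    between-base : ∀ j y {w} → y ⊆ w → w ⊆ replicate j b ++ y → ∃ λ i → w ≡ replicate i b ++ y
    between-base zero    y       p            q           = 0 , ⊆-antisym q p
    between-base (suc j) y       p            (_ ∷ʳ q)    = between-base j y p q
    between-base (suc j) y       (_ ∷ʳ p)     (refl ∷ q)  =
      let i , eq = between-base j y p q in suc i , cong (b ∷_) eq
    -- The leading `b` of `y` moves into the block, so the recursion descends on `y` while the
    -- exponent stays `suc j`.
    between-base (suc j) (_ ∷ y) (refl ∷ p)   (refl ∷ q)  =
      let i , eq = between-base (suc j) y p (subst (_ ⊆_) (replicate-++-∷ j) q)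
      in i , trans (cong (b ∷_) eq) (sym (replicate-++-∷ i))

    between : ∀ j x {y w} → x ++ y ⊆ w → w ⊆ x ++ replicate j b ++ y →
              ∃ λ i → w ≡ x ++ replicate i b ++ y
    between j []      {y} p q = between-base j y p q
    between j (c ∷ x) (refl ∷ p) q =
      let i , eq = between j x p (∷⁻ q) in i , cong (c ∷_) eq
    between j (c ∷ x) (_ ∷ʳ p) (refl ∷ q) =
      let i , eq = between j x (∷ˡ⁻ p) q in i , cong (c ∷_) eq
    -- Both embeddings skip a letter. By `∷-⊈-pumped` this forces `c` and `d` to be `b`, and then
    -- `d` can be matched to `c` after all.
    between j (c ∷ x) (d ∷ʳ p) (.c ∷ʳ q) with c ≟ b | d ≟ b
    ... | yes refl | yes refl =
      let i , eq = between j x (∷ˡ⁻ p) (∷ˡ⁻ q) in i , cong (b ∷_) eq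
    ... | no c≢b   | _        = contradiction (⊆-trans (d ∷ʳ p) q) (∷-⊈-pumped c≢b j x)
    ... | _        | no d≢b   =
      contradiction (⊆-trans (refl ∷ ∷ˡ⁻ p) q) (∷-⊈-pumped d≢b j x)

    insertion-⊆-pumped⇒≡ : ∀ j x {y w} → x ++ y ⊆ w → length w ≡ suc (length (x ++ y)) →
                           w ⊆ x ++ replicate j b ++ y → w ≡ x ++ b ∷ y
    insertion-⊆-pumped⇒≡ j x {y} {w} p len q = trans eq (cong (λ k → x ++ replicate k b ++ y) i≡1)
      where
      i = proj₁ (between j x p q)
      eq = proj₂ (between j x p q)

      length-pumped : ∀ x i → length (x ++ replicate i b ++ y) ≡ i + length (x ++ y)
      length-pumped []      i =
        trans (length-++ (replicate i b)) (cong (_+ length y) (length-replicate i))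
      length-pumped (c ∷ x) i = trans (cong suc (length-pumped x i)) (sym (+-suc i _))

      i≡1 : i ≡ 1
      i≡1 = +-cancelʳ-≡ (length (x ++ y)) i 1
              (trans (sym (length-pumped x i)) (trans (cong length (sym eq)) len))

    OtherInsertion : List A → List A → List A → Set a
    OtherInsertion x y v = ∃ λ w →
      x ++ y ⊆ w × w ⊆ v × length w ≡ suc (length (x ++ y)) × w ≢ x ++ b ∷ y

  ⊆⇒≡⊎insertion : ∀ {u v : List A} → u ⊆ v →
                  u ≡ v ⊎ ∃₂ λ x y → ∃ λ b → u ≡ x ++ y × x ++ b ∷ y ⊆ v
  ⊆⇒≡⊎insertion []         = inj₁ refl
  ⊆⇒≡⊎insertion (d ∷ʳ u⊆v) = inj₂ ([] , _ , d , refl , refl ∷ u⊆v)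
  ⊆⇒≡⊎insertion {c ∷ _} (refl ∷ u⊆v) with ⊆⇒≡⊎insertion u⊆v
  ... | inj₁ eq                     = inj₁ (cong (c ∷_) eq)
  ... | inj₂ (x , y , b , eq , ins) = inj₂ (c ∷ x , y , b , cong (c ∷_) eq , refl ∷ ins)

  -- Complements `insertion-⊆-pumped⇒≡`. Follow an embedding of `x ++ y` in `v`. A skipped letter is
  -- absorbed if it equals the next letter of `x` or, past `x`, the letter `b`; any other one,
  -- inserted where it is skipped, gives a word that differs from `x ++ b ∷ y` at that very place.
  pumped⊎otherInsertion : ∀ b x y {v} → x ++ y ⊆ v →
    (∃ λ i → v ≡ x ++ replicate i b ++ y) ⊎ OtherInsertion b x y v
  pumped⊎otherInsertion b [] [] [] = inj₁ (0 , refl)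
  pumped⊎otherInsertion b [] y (d ∷ʳ p) with d ≟ b
  ... | no d≢b = inj₂ (d ∷ y , d ∷ʳ ⊆-refl , refl ∷ p , refl , d≢b ∘ ∷-injectiveˡ)
  ... | yes refl with pumped⊎otherInsertion b [] y p
  ...   | inj₁ (i , eq)                = inj₁ (suc i , cong (b ∷_) eq)
  ...   | inj₂ (w , y⊆w , w⊆v , other) = inj₂ (w , y⊆w , b ∷ʳ w⊆v , other)
  pumped⊎otherInsertion b [] (d ∷ y) (refl ∷ p) with d ≟ b
  ... | yes refl with pumped⊎otherInsertion b [] y p
  ...   | inj₁ (i , eq) = inj₁ (i , trans (cong (b ∷_) eq) (sym (replicate-++-∷ i)))
  ...   | inj₂ (w , y⊆w , w⊆v , len , w≢) =
    inj₂ (b ∷ w , refl ∷ y⊆w , refl ∷ w⊆v , cong suc len , w≢ ∘ ∷-injectiveʳ)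
  -- Every insertion behind `d` still begins with `d`, so it differs from `b ∷ d ∷ y`. If there is
  -- none, `v` is `d ∷ y` itself, the case of exponent 0.
  pumped⊎otherInsertion b [] (d ∷ y) (refl ∷ p) | no d≢b with ⊆⇒≡⊎insertion p
  ... | inj₁ refl = inj₁ (0 , refl)
  ... | inj₂ (x′ , y′ , c , refl , ins) =
    inj₂ (d ∷ x′ ++ c ∷ y′ , refl ∷ ++⁺ (⊆-refl {x = x′}) (c ∷ʳ ⊆-refl) , refl ∷ ins ,
          cong suc (length-insert x′) , d≢b ∘ ∷-injectiveˡ)
  pumped⊎otherInsertion b (c ∷ x) y (d ∷ʳ p) with d ≟ c
  ... | no d≢c = inj₂ (d ∷ c ∷ x ++ y , d ∷ʳ ⊆-refl , refl ∷ p , refl , d≢c ∘ ∷-injectiveˡ)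
  ... | yes refl with pumped⊎otherInsertion b x y (∷ˡ⁻ p)
  ...   | inj₁ (i , eq) = inj₁ (i , cong (c ∷_) eq)
  ...   | inj₂ (w , xy⊆w , w⊆v , len , w≢) =
    inj₂ (c ∷ w , refl ∷ xy⊆w , refl ∷ w⊆v , cong suc len , w≢ ∘ ∷-injectiveʳ)
  pumped⊎otherInsertion b (c ∷ x) y (refl ∷ p) with pumped⊎otherInsertion b x y p
  ... | inj₁ (i , eq) = inj₁ (i , cong (c ∷_) eq)
  ... | inj₂ (w , xy⊆w , w⊆v , len , w≢) =
    inj₂ (c ∷ w , refl ∷ xy⊆w , refl ∷ w⊆v , cong suc len , w≢ ∘ ∷-injectiveʳ)

  -- Pumping a letter at a fixed level.

  infix 4 _≲[_]_

  -- Half of `∼[ n ]`. It suffices when `v` is a subword of `u`, since the other half is then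
  -- automatic; see `⊆∧≲⇒∼`.
  _≲[_]_ : List A → ℕ → List A → Set a
  u ≲[ n ] v = ∀ t → length t ≤ n → t ⊆ u → t ⊆ v

  ++-∷-⊆-++⁻ : ∀ r x {b : A} {s y} → r ++ b ∷ s ⊆ x ++ y → r ++ [ b ] ⊆ x ⊎ b ∷ s ⊆ y
  ++-∷-⊆-++⁻ []      (c ∷ x) (refl ∷ p) = inj₁ (refl ∷ minimum x)
  ++-∷-⊆-++⁻ (c ∷ r) (_ ∷ x) (refl ∷ p) = Sum.map₁ (refl ∷_) (++-∷-⊆-++⁻ r x p)
  ++-∷-⊆-++⁻ r       (c ∷ x) (_ ∷ʳ p)   = Sum.map₁ (c ∷ʳ_) (++-∷-⊆-++⁻ r x p)
  ++-∷-⊆-++⁻ r       []      p          = inj₂ (⊆-trans (++⁺ˡ r ⊆-refl) p)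

  -- A short subword of the pumped word is `r`, then a block of `b`s, then `s`. The hypothesis is
  -- used once per copy of `b`, on a word `r ++ b ∷ s` no longer than the given one; `r` and `s`
  -- grow by the copies already absorbed.
  pump : ∀ n x b y → x ++ b ∷ y ≲[ n ] x ++ y → ∀ j → x ++ replicate j b ++ y ≲[ n ] x ++ y
  pump n x b y absorb j t len t⊆ with ⊆-++⁻ x t⊆
  ... | r , _ , refl , r⊆x , s⊆ with ⊆-++⁻ (replicate j b) s⊆
  ...   | _ , s , refl , bs⊆ , s⊆y with ⊆-replicate⁻ j bs⊆
  ...     | i , refl = go i r s r⊆x s⊆y len
    where
    -- As r b s ⊆ xy, one of x, y absorbs the b, which leaves a shorter block of b's.
    go : ∀ i r s → r ⊆ x → s ⊆ y → length (r ++ replicate i b ++ s) ≤ n →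
         r ++ replicate i b ++ s ⊆ x ++ y
    go zero    r s r⊆x s⊆y len = ++⁺ r⊆x s⊆y
    go (suc i) r s r⊆x s⊆y len
      with ++-∷-⊆-++⁻ r x (absorb (r ++ b ∷ s)
             (≤-trans (length-mono-≤
               (++⁺ (⊆-refl {x = r}) (refl ∷ ++⁺ˡ (replicate i b) ⊆-refl))) len)
             (++⁺ r⊆x (refl ∷ s⊆y)))
    ... | inj₁ rb⊆x = subst (_⊆ x ++ y) eq
        (go i (r ++ [ b ]) s rb⊆x s⊆y (subst (λ w → length w ≤ n) (sym eq) len))
      where eq = ++-assoc r [ b ] (replicate i b ++ s)
    ... | inj₂ bs⊆y = subst (_⊆ x ++ y) eq
        (go i r (b ∷ s) r⊆x bs⊆y (subst (λ w → length w ≤ n) (sym eq) len))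
      where eq = cong (r ++_) (replicate-++-∷ i)

  -- Short equivalent subwords through rich factorizations.

  Shrinks : ℕ → ℕ → List A → Set a
  Shrinks N n u = ∃ λ v → v ⊆ u × length v ≤ N × u ≲[ n ] v

  -- Universality: equivalent to `v` having `m` successive disjoint factors that each contain all
  -- letters of `cs`, but stated in the form in which it is applied.
  Rich : List A → ℕ → List A → Set a
  Rich cs m v = ∀ t → All (_∈ cs) t → length t ≤ m → t ⊆ v

  rich-block : ∀ {cs m u c v} → All (λ e → [ e ] ⊆ u ++ [ c ]) cs → Rich cs m v →
               Rich cs (suc m) (u ++ c ∷ v)
  rich-block all rich []      _          _         = minimum _
  rich-block all rich (e ∷ t) (e∈ ∷ t∈)  (s≤s len) =
    ++-insert-⊆ (All.lookup all e∈) (rich t t∈ len)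

  -- The block `u′ ++ [ c ]` always takes at least one letter of `t`: a letter of `r`, or `c`
  -- itself, or, failing both, the first letter of `s`, as the block contains every letter. Hence at
  -- most `m + d` letters are left for `v′`.
  ≲-block : ∀ {cs m d u u′ c v v′} → All (_∈ cs) (u ++ c ∷ v) →
            All (λ e → [ e ] ⊆ u′ ++ [ c ]) cs → Rich cs m v′ →
            u ≲[ suc d ] u′ → v ≲[ m + d ] v′ →
            u ++ c ∷ v ≲[ suc m + d ] u′ ++ c ∷ v′
  ≲-block {cs} {m} {d} {u} {u′} {c} {v} {v′} over all rich u≲ v≲ t len t⊆
    with ⊆-++⁻ u t⊆
  ... | r , s , refl , r⊆u , s⊆cv with length r ≤? suc d
  -- A long r is cut after d + 1 letters, since the m-rich v′ accommodates all the rest of t.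
  ...   | no r≰ = subst (_⊆ u′ ++ c ∷ v′) eq (++⁺ p⊆u′ (c ∷ʳ q⊆v′))
    where
    p = take (suc d) r
    q = drop (suc d) r ++ s

    eq : p ++ q ≡ r ++ s
    eq = trans (sym (++-assoc p _ s)) (cong (_++ s) (take++drop≡id (suc d) r))

    length-p : length p ≡ suc d
    length-p = trans (length-take (suc d) r) (m≤n⇒m⊓n≡m (<⇒≤ (≰⇒> r≰)))

    p⊆u′ : p ⊆ u′
    p⊆u′ = u≲ p (≤-reflexive length-p) (⊆-trans (take-⊆ (suc d) r) r⊆u)

    length-q : length q ≤ m
    length-q = +-cancelˡ-≤ (suc d) _ _ (begin
      suc d + length q    ≡⟨ cong (_+ length q) length-p ⟨
      length p + length q ≡⟨ length-++ p ⟨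
      length (p ++ q)     ≡⟨ cong length eq ⟩
      length (r ++ s)     ≤⟨ len ⟩
      suc m + d           ≡⟨ cong suc (+-comm m d) ⟩
      suc d + m           ∎)
      where open ≤-Reasoning

    q⊆v′ : q ⊆ v′
    q⊆v′ = rich q (All.++⁻ʳ p (subst (All (_∈ cs)) (sym eq) (All-resp-⊆ t⊆ over))) length-q
  ...   | yes r≤ with r | s | s⊆cv | u≲ r r≤ r⊆u
  ...     | r     | _ ∷ s | refl ∷ s⊆v | r⊆u′ = ++⁺ r⊆u′ (refl ∷ v≲ s (s≤s⁻¹ (begin
      suc (length s)            ≤⟨ m≤n+m _ (length r) ⟩
      length r + suc (length s) ≡⟨ length-++ r ⟨
      length (r ++ c ∷ s)       ≤⟨ len ⟩
      suc m + d                 ∎)) s⊆v)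
      where open ≤-Reasoning
  ...     | []    | []    | _          | _    = minimum _
  ...     | []    | e ∷ s | _ ∷ʳ s⊆v   | _    =
      ++-insert-⊆ (All.lookup all (All.head (All-resp-⊆ t⊆ over))) (v≲ s (s≤s⁻¹ len) (∷ˡ⁻ s⊆v))
  ...     | e ∷ r | s     | _ ∷ʳ s⊆v   | r⊆u′ = ++⁺ r⊆u′ (c ∷ʳ v≲ s (begin
      length s            ≤⟨ m≤n+m _ (length r) ⟩
      length r + length s ≡⟨ length-++ r ⟨
      length (r ++ s)     ≤⟨ s≤s⁻¹ len ⟩
      m + d               ∎) s⊆v)
      where open ≤-Reasoning

  first-prefix : ∀ {p} {P : Pred (List A) p} → Decidable P → ¬ P [] → ∀ {u} → P u →
                 ∃₂ λ v c → ∃ λ w → u ≡ v ++ c ∷ w × ¬ P v × P (v ++ [ c ])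
  first-prefix P? ¬P[] {[]}    Pu = contradiction Pu ¬P[]
  first-prefix P? ¬P[] {c ∷ u} Pu with P? [ c ]
  ... | yes Pc = [] , c , u , refl , ¬P[] , Pc
  ... | no ¬Pc = let v , e , w , eq , ¬Pv , Pve = first-prefix (P? ∘ (c ∷_)) ¬Pc Pu in
    c ∷ v , e , w , cong (c ∷_) eq , ¬Pv , Pve

  missing : ∀ {cs u} → ¬ All (_∈ u) cs → ∃ λ c → c ∈ cs × ¬ c ∈ u
  missing {u = u} ¬all = find (¬All⇒Any¬ (_∈? u) _ ¬all)

  -- m is the number of blocks taken from the rich factorization (at most n), and d = n − m.
  RichShrinks : (ℕ → ℕ) → List A → ℕ → List A → Set a
  RichShrinks F cs n u = ∃₂ λ m d → m + d ≡ n × ∃ λ v →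
    v ⊆ u × length v ≤ m * F (suc d) + m + F d × u ≲[ n ] v × Rich cs m v

  -- Each `u₁` misses a letter because its prefix is minimal, so `poor` applies to it. In the
  -- recursion `n` and `m` fall together, so `d` is common to all blocks: each costs at most
  -- `F (suc d) + 1` letters, and the remainder at most `F d`.
  rich-shrink : ∀ F {c cs} →
    (∀ n {e u} → e ∈ c ∷ cs → All (_∈ c ∷ cs) u → ¬ e ∈ u → Shrinks (F n) n u) →
    ∀ n u → All (_∈ c ∷ cs) u → RichShrinks F (c ∷ cs) n u
  -- Once the level is used up by blocks, the rest of the word is dropped, as only the empty word is
  -- tested.
  rich-shrink F poor zero u u∈ =
    0 , 0 , refl , [] , minimum u , z≤n , (λ { [] _ _ → [] }) , λ { [] _ _ → [] }
  rich-shrink F {c} {cs} poor (suc n) u u∈ with All.all? (_∈? u) (c ∷ cs)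
  ... | no ¬all = let e , e∈ , e∉ = missing ¬all
                      v , v⊆u , len , u≲v = poor (suc n) e∈ u∈ e∉
    in 0 , suc n , refl , v , v⊆u , len , u≲v , λ { [] _ _ → minimum v }
  ... | yes all with first-prefix (λ w → All.all? (_∈? w) (c ∷ cs)) (λ { (() ∷ _) }) all
  ...   | u₁ , b , u₂ , refl , ¬all₁ , all₁ with missing ¬all₁
  ...     | e , e∈ , e∉ with rich-shrink F poor n u₂ (All.tail (All.++⁻ʳ u₁ u∈))
  ...       | m , d , refl , v₂ , v₂⊆u₂ , len₂ , u₂≲v₂ , rich₂
            -- The level for `u₁` depends on the number of blocks found in `u₂`, so `u₁` is shrunk
            -- only after the recursive call.
            with poor (suc d) e∈ (All.++⁻ˡ u₁ u∈) e∉
  ...         | v₁ , v₁⊆u₁ , len₁ , u₁≲v₁ =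
    suc m , d , refl , v₁ ++ b ∷ v₂ , ++⁺ v₁⊆u₁ (refl ∷ v₂⊆u₂) , len ,
    ≲-block u∈ all₂ rich₂ u₁≲v₁ u₂≲v₂ , rich-block all₂ rich₂
    where
    all₂ : All (λ e → [ e ] ⊆ v₁ ++ [ b ]) (c ∷ cs)
    all₂ = All.map (λ e∈ → kept (∈-++⁻ u₁ e∈)) all₁
      where
      kept : ∀ {e} → e ∈ u₁ ⊎ e ∈ [ b ] → [ e ] ⊆ v₁ ++ [ b ]
      -- The level `suc d` is at least 1, so no letter of `u₁` gets lost.
      kept (inj₁ e∈) = ++⁺ʳ [ b ] (u₁≲v₁ _ (s≤s z≤n) (from∈ e∈))
      kept (inj₂ e∈) = ++⁺ˡ v₁ (from∈ e∈)

    len : length (v₁ ++ b ∷ v₂) ≤ suc m * F (suc d) + suc m + F d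
    len = begin
      length (v₁ ++ b ∷ v₂)                          ≡⟨ length-insert v₁ ⟩
      suc (length (v₁ ++ v₂))                        ≡⟨ cong suc (length-++ v₁) ⟩
      suc (length v₁ + length v₂)                    ≤⟨ s≤s (+-mono-≤ len₁ len₂) ⟩
      suc (F (suc d) + (m * F (suc d) + m + F d))    ≡⟨ rearrange (F (suc d)) (F d) m ⟩
      suc m * F (suc d) + suc m + F d                ∎
      where
      open ≤-Reasoning
      open +-*-Solver

      rearrange : ∀ p q m → suc (p + (m * p + m + q)) ≡ p + m * p + suc m + q
      rearrange = solve 3 (λ p q m →
        con 1 :+ (p :+ (m :* p :+ m :+ q)) := p :+ m :* p :+ (con 1 :+ m) :+ q) refl

  unary-shrink : ∀ {c} n u → All (_∈ [ c ]) u → u ≲[ n ] take n u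
  unary-shrink n       u       u∈           []      _         _  = minimum _
  unary-shrink (suc n) (e ∷ u) (here refl ∷ u∈) (b ∷ t) (s≤s len) t⊆
    with here refl ← All.lookup (here refl ∷ u∈) (Any-resp-⊆ t⊆ (here refl)) =
    refl ∷ unary-shrink n u u∈ t len (∷⁻ t⊆)

  -- The left side is the term of index `m` in the maximum that defines `f` at `m + d`.
  f-bound : ∀ k m d → m * f (suc k) (suc d) + m + f (suc k) d ≤ f (suc (suc k)) (m + d)
  f-bound k m d = subst (_≤ f (suc (suc k)) (m + d))
    (cong₂ (λ i j → m * f (suc k) i + m + f (suc k) j) (m+n+1∸m m d) (m+n∸m≡n m d))
    (All.lookup (xs≤max 0 _) (∈-map⁺ _ (∈-upTo⁺ (s≤s (m≤m+n m d)))))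
    where
    m+n+1∸m : ∀ m d → m + d + 1 ∸ m ≡ suc d
    m+n+1∸m m d = trans (cong (_∸ m) (+-assoc m d 1)) (trans (m+n∸m≡n m (d + 1)) (+-comm d 1))

  -- Induction on the number of letters. The alphabet is a list over the fixed type `A`, so a word
  -- that misses `e` can be passed on with one occurrence of `e` deleted from the list.
  shrink : ∀ k cs → length cs ≡ suc k → ∀ n u → All (_∈ cs) u → Shrinks (f (suc k) n) n u
  shrink zero (c ∷ []) refl n u u∈ = take n u , take-⊆ n u ,
    ≤-trans (≤-reflexive (length-take n u)) (m⊓n≤m n (length u)) , unary-shrink n u u∈
  shrink (suc k) (c ∷ cs) eq n u u∈ =
    let m , d , m+d≡n , v , v⊆u , len , u≲v , _ = rich-shrink (f (suc k)) poor n u u∈ in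
    v , v⊆u ,
    ≤-trans len (≤-trans (f-bound k m d) (≤-reflexive (cong (f (suc (suc k))) m+d≡n))) , u≲v
    where
    poor : ∀ n {e u} → e ∈ c ∷ cs → All (_∈ c ∷ cs) u → ¬ e ∈ u → Shrinks (f (suc k) n) n u
    poor n {e} {u} e∈ u∈ e∉u with ∈-∃++ e∈
    ... | ys , zs , split = shrink k (ys ++ zs) length-rest n u
        (All.tabulate λ {x} x∈u → remains x∈u (∈-++⁻ ys (subst (x ∈_) split (All.lookup u∈ x∈u))))
      where
      length-rest : length (ys ++ zs) ≡ suc k
      length-rest = suc-injective (trans (sym (length-insert ys)) (trans (sym (cong length split)) eq))

      remains : ∀ {x} → x ∈ u → x ∈ ys ⊎ x ∈ e ∷ zs → x ∈ ys ++ zs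
      remains x∈u (inj₁ x∈ys)         = ∈-++⁺ˡ x∈ys
      remains x∈u (inj₂ (here refl))  = contradiction x∈u e∉u
      remains x∈u (inj₂ (there x∈zs)) = ∈-++⁺ʳ ys x∈zs

  -- Transfer of incomparability along equivalent words.

  ∼⇒≲ : ∀ {n} {u v : List A} → u ∼[ n ] v → u ≲[ n ] v
  ∼⇒≲ u∼v t len = Equivalence.to (u∼v t len)

  ∼-sym : ∀ {n} {u v : List A} → u ∼[ n ] v → v ∼[ n ] u
  ∼-sym u∼v t len = mk⇔ (Equivalence.from (u∼v t len)) (Equivalence.to (u∼v t len))

  ⊆∧≲⇒∼ : ∀ {n} {u v : List A} → u ⊆ v → v ≲[ n ] u → v ∼[ n ] u
  ⊆∧≲⇒∼ u⊆v v≲u t len = mk⇔ (v≲u t len) (λ t⊆u → ⊆-trans t⊆u u⊆v)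

  -- If `u` were longer than `N`, its prefix of length `N + 1` would be tested and would embed in
  -- the shorter `v`. So both words are short enough to be tested against each other.
  short-∼⇒≡ : ∀ {N} {u v : List A} → length v ≤ N → u ∼[ suc N ] v → u ≡ v
  short-∼⇒≡ {N} {u} {v} v≤N u∼v = ⊆-antisym
    (∼⇒≲ u∼v u (m≤n⇒m≤1+n u≤N) ⊆-refl) (∼⇒≲ (∼-sym u∼v) v (m≤n⇒m≤1+n v≤N) ⊆-refl)
    where
    prefix = take (suc N) u

    prefix≤N : length prefix ≤ N
    prefix≤N = ≤-trans (length-mono-≤ (∼⇒≲ u∼v prefix
      (≤-trans (≤-reflexive (length-take (suc N) u)) (m⊓n≤m (suc N) (length u)))
      (take-⊆ (suc N) u))) v≤N

    u≤N : length u ≤ N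
    u≤N with length u ≤? N
    ... | yes u≤N = u≤N
    ... | no u≰N  = contradiction prefix≤N (<⇒≱ (≤-reflexive (sym
      (trans (length-take (suc N) u) (m≤n⇒m⊓n≡m (≰⇒> u≰N))))))

  short-⊥ : ∀ {w u′ : List A} → length w ≤ length u′ → ¬ w ⊆ u′ → u′ ⊥ w
  short-⊥ w≤u′ w⊈u′ = (λ u′⊆w → w⊈u′ (⊆-reflexive (sym (⊆-length⇒≡ u′⊆w w≤u′)))) , w⊈u′

  I-closed : ∀ {ℓ N n} {L : Pred (List A) ℓ} →
    (∀ {v w} → L v → v ∼[ n ] w → L w) → (∀ v → Shrinks N n v) →
    ∀ {u u′} → u ∼[ suc N ] u′ → I L u → I L u′
  I-closed {N = N} {n} {L} closed shrinks {u} {u′} u∼u′ (v , v∈L , u⊈v , v⊈u)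
    with length u′ ≤? N
  ... | yes u′≤N with refl ← short-∼⇒≡ u′≤N u∼u′ = v , v∈L , u⊈v , v⊈u
  ... | no u′≰N with shrinks v
  ...   | v₀ , v₀⊆v , v₀≤N , v≲v₀ = by-v₀
    where
    N<u′ : N < length u′
    N<u′ = ≰⇒> u′≰N

    in-L : ∀ {w} → w ⊆ v → v₀ ⊆ w → L w
    in-L w⊆v v₀⊆w = closed v∈L
      (⊆∧≲⇒∼ w⊆v (λ t len t⊆v → ⊆-trans (v≲v₀ t len t⊆v) v₀⊆w))

    short-witness : ∀ {w} → w ⊆ v → v₀ ⊆ w → length w ≤ suc N → ¬ w ⊆ u → I L u′
    short-witness w⊆v v₀⊆w w≤ w⊈u = _ , in-L w⊆v v₀⊆w ,
      short-⊥ (≤-trans w≤ N<u′) (w⊈u ∘ ∼⇒≲ (∼-sym u∼u′) _ w≤)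

    module _ {x y b} (v₀≡xy : v₀ ≡ x ++ y) (xby⊆v : x ++ b ∷ y ⊆ v) where

      xy⊆v : x ++ y ⊆ v
      xy⊆v = subst (_⊆ v) v₀≡xy v₀⊆v

      insertion≤ : ∀ w → length w ≡ suc (length (x ++ y)) → length w ≤ suc N
      -- As `x ++ y` is `v₀`, of length at most `N`, its one-letter insertions just fit the level
      -- `suc N` at which `u` and `u′` agree.
      insertion≤ w len = ≤-trans (≤-reflexive len)
        (s≤s (subst (λ w → length w ≤ N) v₀≡xy v₀≤N))

      -- Chosen so that the block of `b`s alone is longer than `u′`.
      J : ℕ
      J = suc (length u′)

      pumped : List A
      pumped = x ++ replicate J b ++ y

      xy⊆pumped : x ++ y ⊆ pumped
      xy⊆pumped = ++⁺ (⊆-refl {x = x}) (++⁺ˡ (replicate J b) ⊆-refl)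

      pumped∈L : L pumped
      pumped∈L = closed (in-L xy⊆v (⊆-reflexive v₀≡xy)) (∼-sym (⊆∧≲⇒∼ xy⊆pumped
        -- The word `x ++ b ∷ y` lies in `v`, whose short subwords all occur in `v₀`, that is, in
        -- `x ++ y`; this is the absorption that `pump` asks for.
        (pump n x b y (λ t len t⊆ → subst (t ⊆_) v₀≡xy (v≲v₀ t len (⊆-trans t⊆ xby⊆v))) J)))

      pumped⊈u′ : ¬ pumped ⊆ u′
      pumped⊈u′ p = <⇒≱ (n<1+n (length u′)) (begin
        J                      ≡⟨ length-replicate J ⟨
        length (replicate J b) ≤⟨ length-mono-≤ bs⊆pumped ⟩
        length pumped          ≤⟨ length-mono-≤ p ⟩
        length u′              ∎)
        where
        open ≤-Reasoning

        bs⊆pumped : replicate J b ⊆ pumped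
        bs⊆pumped = ++⁺ˡ x (++⁺ʳ y ⊆-refl)

      pumped-witness : OtherInsertion b x y u → I L u′
      pumped-witness (w , xy⊆w , w⊆u , len , w≢) = pumped , pumped∈L ,
        (λ u′⊆pumped → w≢ (insertion-⊆-pumped⇒≡ b J x xy⊆w len
          (⊆-trans (∼⇒≲ u∼u′ w (insertion≤ w len) w⊆u) u′⊆pumped))) ,
        pumped⊈u′

      comparable : ∀ i j → x ++ replicate i b ++ y ⊆ x ++ replicate j b ++ y
                         ⊎ x ++ replicate j b ++ y ⊆ x ++ replicate i b ++ y
      comparable i j = Sum.map widen widen (≤-total i j)
        where
        replicate-mono : ∀ {i j} → i ≤ j → replicate i b ⊆ replicate j b
        replicate-mono z≤n     = minimum _
        replicate-mono (s≤s p) = refl ∷ replicate-mono p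

        widen : ∀ {i j} → i ≤ j → x ++ replicate i b ++ y ⊆ x ++ replicate j b ++ y
        widen i≤j = ++⁺ (⊆-refl {x = x}) (++⁺ (replicate-mono i≤j) ⊆-refl)

      by-insertion : v₀ ⊆ u → I L u′
      by-insertion v₀⊆u with pumped⊎otherInsertion b x y xy⊆v
      ... | inj₂ (w , xy⊆w , w⊆v , len , w≢) with w ⊆? u
      -- An insertion found in `v` serves in either case: inside `u` it keeps `u′` out of the pumped
      -- word, outside `u` it is itself the witness.
      ...   | yes w⊆u = pumped-witness (w , xy⊆w , w⊆u , len , w≢)
      ...   | no w⊈u  = short-witness w⊆v (subst (_⊆ w) (sym v₀≡xy) xy⊆w) (insertion≤ w len) w⊈u
      by-insertion v₀⊆u | inj₁ (i , v≡)
        with pumped⊎otherInsertion b x y (subst (_⊆ u) v₀≡xy v₀⊆u)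
      ... | inj₂ other = pumped-witness other
      ... | inj₁ (j , refl) with refl ← v≡ | comparable i j
      ...   | inj₁ v⊆u = contradiction v⊆u v⊈u
      ...   | inj₂ u⊆v = contradiction u⊆v u⊈v

    by-v₀ : I L u′
    by-v₀ with v₀ ⊆? u
    ... | no v₀⊈u = short-witness v₀⊆v ⊆-refl (m≤n⇒m≤1+n v₀≤N) v₀⊈u
    ... | yes v₀⊆u with ⊆⇒≡⊎insertion v₀⊆v
    ...   | inj₁ refl = contradiction v₀⊆u v⊈u
    ...   | inj₂ (x , y , b , v₀≡xy , xby⊆v) = by-insertion v₀≡xy xby⊆v v₀⊆u

-- Unions of classes as saturated languages, and the conclusion.

PT-closed : ∀ {a ℓ} {A : Set a} {n} {L : Pred (List A) ℓ} → n -PT L →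
            ∀ {v w} → L v → v ∼[ n ] w → L w
PT-closed (S , L⊆ , L⊇) v∈L v∼w =
  let u , u∈S , u∼v = L⊆ v∈L in
  L⊇ (u , u∈S , λ t len → v∼w t len ⇔-∘ u∼v t len)

-- A saturated language serves as its own set of representatives.
closed⇒PT : ∀ {a ℓ} {A : Set a} {n} {L : Pred (List A) ℓ} →
            (∀ {v w} → v ∼[ n ] w → L v → L w) → n -PT L
closed⇒PT {L = L} closed =
  L , (λ v∈L → _ , v∈L , λ _ _ → mk⇔ id id) , λ (_ , u∈L , u∼v) → closed u∼v u∈L

theorem20 : ∀ {a ℓ : Level} (A : Set a) (k : ℕ) .{{_ : NonZero k}} → A ↔ Fin k →
    (n : ℕ) (L : Pred (List A) ℓ) → n -PT L → (f k n + 1) -PT (I L)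
theorem20 A (suc k) A↔Fin n L PT-L = subst (_-PT I L) (+-comm 1 (f (suc k) n))
  (closed⇒PT (I-closed (PT-closed PT-L) λ v →
    shrink k alphabet length-alphabet n v (All.tabulate λ {c} _ → ∈-alphabet c)))
  where
  open Inverse A↔Fin using (from; strictlyInverseʳ; to)
  open Words (via-injection (Inverse⇒Injection A↔Fin) Fin._≟_)

  alphabet : List A
  alphabet = map from (allFin (suc k))

  length-alphabet : length alphabet ≡ suc k
  length-alphabet = trans (length-map from (allFin (suc k))) (length-tabulate id)

  ∈-alphabet : ∀ c → c ∈ alphabet
  ∈-alphabet c = subst (_∈ alphabet) (strictlyInverseʳ c) (∈-map⁺ from (∈-allFin (to c)))
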